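{- Let $T$ be a nontrivial tree. Then $\gamma_{t2}(T)=\frac{2[n(T)-l(T)+2]}{5}$ if and only if $(T,S)\in\mathscr{T}$ for some labeling $S$ of $T$.
   Context: For a graph $G$ without isolated vertices, a set $D\subseteq V(G)$ is a semitotal dominating set if every vertex of $V(G)\setminus D$ is adjacent to a vertex of $D$, and every vertex of $D$ is at distance at most $2$ from some other vertex of $D$; $\gamma_{t2}(G)$ is the minimum cardinality of such a set. For a tree $T$, $n(T)$ is its number of vertices and $l(T)$ its number of leaves. A labeling of a tree $T$ is a partition $S=(S_A,S_B,S_C)$ of $V(T)$; the status $\mathrm{sta}(v)$ of a vertex $v$ is the letter $x\in\{A,B,C\}$ with $v\in S_x$, and $(T,S)$ is called a labeled tree. The family $\mathscr{T}$ of labeled trees is the smallest family that (i) contains $(P_5,S')$, where $S'$ gives the two support vertices (neighbors of leaves) of the path $P_5$ status $A$, the two leaves status $C$, and the center vertex status $B$; and (ii) is closed under the following two operations applied to a labeled tree $(T',S^*)$ in the family: Operation $\mathscr{O}_1$: choose a vertex $v$ with $\mathrm{sta}(v)=A$, add a new vertex $u$ and the edge $uv$, and give $u$ status $C$. Operation $\mathscr{O}_2$: choose a vertex $v$ with $\mathrm{sta}(v)=C$ and degree one, add a new path $u_1u_2u_3u_4u_5$ and the edge $u_1v$, and set $\mathrm{sta}(u_1)=\mathrm{sta}(u_5)=C$, $\mathrm{sta}(u_2)=\mathrm{sta}(u_4)=A$, $\mathrm{sta}(u_3)=B$ (all other statuses unchanged). -}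

module Defs where

open import Data.Nat using (ℕ; zero; suc; _+_; _*_; _∸_; _≤_)
open import Data.Bool using (Bool; true; false; if_then_else_)
open import Data.Fin using (Fin; zero; suc; _≟_)
open import Data.Fin.Permutation using (Permutation′; _⟨$⟩ʳ_)
open import Data.List using (List; []; _∷_; _++_; length; map; allFin)
open import Data.Nat.ListAction using (sum)
open import Data.List.Relation.Unary.Linked using (Linked)
open import Data.List.Relation.Unary.Unique.Propositional using (Unique)
open import Data.Product using (Σ; ∃; ∃₂; _×_; _,_)
open import Data.Sum using (_⊎_)
open import Relation.Binary.PropositionalEquality using (_≡_; _≢_)
open import Relation.Nullary.Decidable using (⌊_⌋)

-- Simple graphs on the vertex set Fin n, given by a Boolean adjacency
-- function (symmetry / irreflexivity are imposed as hypotheses).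

Graph : ℕ → Set
Graph n = Fin n → Fin n → Bool

Adj : ∀ {n} → Graph n → Fin n → Fin n → Set
Adj G u v = G u v ≡ true

Symmetric : ∀ {n} → Graph n → Set
Symmetric G = ∀ u v → G u v ≡ G v u

Irreflexive : ∀ {n} → Graph n → Set
Irreflexive G = ∀ v → G v v ≡ false

Connected : ∀ {n} → Graph n → Set
Connected {n} G = ∀ (u v : Fin n) → u ≢ v →
  Σ (List (Fin n)) λ xs → Linked (Adj G) (u ∷ xs ++ v ∷ [])

HasCycle : ∀ {n} → Graph n → Set
HasCycle {n} G = Σ (Fin n) λ x → Σ (List (Fin n)) λ xs →
  (2 ≤ length xs) × Unique (x ∷ xs) × Linked (Adj G) (x ∷ xs ++ x ∷ [])

Acyclic : ∀ {n} → Graph n → Set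
Acyclic G = HasCycle G → ⊥
  where open import Data.Empty using (⊥)

record IsTree {n : ℕ} (G : Graph n) : Set where
  field
    symmetric   : Symmetric G
    irreflexive : Irreflexive G
    connected   : Connected G
    acyclic     : Acyclic G

count : ∀ {n} → (Fin n → Bool) → ℕ
count {n} P = sum (map (λ u → if P u then 1 else 0) (allFin n))

degree : ∀ {n} → Graph n → Fin n → ℕ
degree G v = count (G v)

isLeaf : ∀ {n} → Graph n → Fin n → Bool
isLeaf G v = ⌊ degree G v Data.Nat.≟ 1 ⌋

leaves : ∀ {n} → Graph n → ℕ
leaves G = count (isLeaf G)

VSet : ℕ → Set
VSet n = Fin n → Bool

size : ∀ {n} → VSet n → ℕ
size D = count D

-- d(u,v) ≤ 2 for distinct u, v
Within2 : ∀ {n} → Graph n → Fin n → Fin n → Set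
Within2 {n} G u v = Adj G u v ⊎ Σ (Fin n) λ w → Adj G u w × Adj G w v

record IsSemitotalDominating {n : ℕ} (G : Graph n) (D : VSet n) : Set where
  field
    dominating : ∀ v → D v ≡ false → Σ (Fin n) λ u → D u ≡ true × Adj G u v
    semitotal  : ∀ v → D v ≡ true →
                 Σ (Fin n) λ u → D u ≡ true × u ≢ v × Within2 G u v

record IsGammaT2 {n : ℕ} (G : Graph n) (k : ℕ) : Set where
  field
    attained : Σ (VSet n) λ D → IsSemitotalDominating G D × size D ≡ k
    minimal  : ∀ D → IsSemitotalDominating G D → k ≤ size D

data Status : Set where
  A B C : Status

Labeling : ℕ → Set
Labeling n = Fin n → Status

addLeaf : ∀ {n} → Graph n → Fin n → Graph (suc n)
addLeaf G v zero    zero    = false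
addLeaf G v zero    (suc j) = ⌊ j ≟ v ⌋
addLeaf G v (suc i) zero    = ⌊ i ≟ v ⌋
addLeaf G v (suc i) (suc j) = G i j

addLab : ∀ {n} → Labeling n → Status → Labeling (suc n)
addLab S x zero    = x
addLab S x (suc i) = S i

K1 : Graph 1
K1 _ _ = false

P5 : Graph 5
P5 = addLeaf (addLeaf (addLeaf (addLeaf K1 zero) zero) zero) zero

P5lab : Labeling 5
P5lab = addLab (addLab (addLab (addLab (λ _ → C) A) B) A) C

attachP5 : ∀ {n} → Graph n → Fin n → Graph (5 + n)
attachP5 G v = addLeaf (addLeaf (addLeaf (addLeaf (addLeaf G v) zero) zero) zero) zero

attachP5lab : ∀ {n} → Labeling n → Labeling (5 + n)
attachP5lab S = addLab (addLab (addLab (addLab (addLab S C) A) B) A) C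

data InT : (n : ℕ) → Graph n → Labeling n → Set where
  base : InT 5 P5 P5lab
  op1  : ∀ {n G S} → InT n G S → (v : Fin n) → S v ≡ A →
         InT (suc n) (addLeaf G v) (addLab S C)
  op2  : ∀ {n G S} → InT n G S → (v : Fin n) → S v ≡ C → degree G v ≡ 1 →
         InT (5 + n) (attachP5 G v) (attachP5lab S)

LabIso : ∀ {n} → Graph n → Labeling n → Graph n → Labeling n → Set
LabIso {n} G S G' S' = Σ (Permutation′ n) λ π →
  (∀ u v → G' (π ⟨$⟩ʳ u) (π ⟨$⟩ʳ v) ≡ G u v) × (∀ u → S' (π ⟨$⟩ʳ u) ≡ S u)

InFamily : ∀ {n} → Graph n → Labeling n → Set
InFamily {n} G S = Σ (Graph n) λ G' → Σ (Labeling n) λ S' → InT n G' S' × LabIso G' S' G S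

{-# OPTIONS --safe #-}
module Submission where

-- Lower bound: let D be semitotal dominating in a tree with N non-leaves.  As the
-- degrees add up to 2n − 2, the number 5|D| − 2(N + 2) is the sum over all vertices
-- of 5[v ∈ D] + 2 deg v − 2[v is not a leaf] − 4.  This is negative only outside D,
-- where gifts from the neighbours in D make up for the deficit; a vertex of D keeps a
-- nonnegative rest because it has a neighbour that is in D or has two neighbours in D.
-- Equality makes every local balance tight, and then D (label A), the vertices outside
-- D with two neighbours in D (label B) and the others (label C) have the local
-- structure of 𝒯.  Starting from a copy of P₅ around a vertex of D, an induced subtree
-- in 𝒯 grows until it is the whole tree: an edge leaving it starts either at an
-- A-vertex (𝒪₁) or at a C-vertex of degree one (𝒪₂).  Conversely, in a member of 𝒯 the
-- set of A-vertices is semitotal dominating and attains the bound.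

open import Defs
open import Algebra.Properties.Semiring.Sum using ()
open import Data.Bool using (Bool; true; false; if_then_else_)
open import Data.Empty using (⊥; ⊥-elim)
open import Data.Fin using (Fin; zero; suc; _≟_; punchIn; punchOut)
open import Data.Fin.Patterns using (0F; 1F; 2F; 3F; 4F)
open import Data.Fin.Permutation
  using (Permutation; permutation; _⟨$⟩ʳ_; _⟨$⟩ˡ_; inverseˡ; inverseʳ; ↔⇒≡)
open import Data.Fin.Properties
  using (suc-injective; punchIn-punchOut; punchOut-injective; punchInᵢ≢i;
         any?; all?; ¬∀⟶∃¬; injective⇒≤)
open import Data.List using (List; []; _∷_; _++_; length; map; tabulate)
open import Data.List.Properties using (map-tabulate)
open import Data.List.Membership.Propositional.Properties using (∈-map⁻)
open import Data.List.Relation.Unary.All using (universal; []; _∷_)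
import Data.List.Relation.Unary.All.Properties as All
open import Data.List.Relation.Unary.Any using (here)
open import Data.List.Relation.Unary.Linked using (Linked; [-]; _∷_)
open import Data.List.Relation.Unary.Unique.Propositional using (Unique; []; _∷_)
import Data.List.Relation.Unary.Unique.Propositional.Properties as Unique
open import Data.Nat
  using (ℕ; zero; suc; _+_; _*_; _∸_; _≤_; _<_; z≤n; s≤s)
open import Data.Nat.ListAction using () renaming (sum to sumᴸ)
open import Data.Nat.Properties hiding (_≟_; suc-injective)
import Data.Nat.Properties as ℕ
open import Data.Nat.Tactic.RingSolver using (solve-∀)
open import Data.Product using (Σ; ∃; ∃₂; _×_; _,_; proj₁; proj₂)
open import Data.Sum using (_⊎_; inj₁; inj₂)
open import Data.Vec.Functional using (removeAt) renaming (_∷_ to _◂_)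
open import Function using (_∘_; Injective)
open import Function.Bundles using (_⇔_; mk⇔)
open import Relation.Binary.PropositionalEquality
open import Relation.Nullary using (¬_; yes; no; contradiction)
open import Relation.Nullary.Decidable using (⌊_⌋; decidable-stable)
open import Relation.Unary using (Decidable)

open Algebra.Properties.Semiring.Sum +-*-semiring

-- Indicators and decidable equality

⟦_⟧ : Bool → ℕ
⟦ b ⟧ = if b then 1 else 0

⟦⟧⁻ : ∀ {b} → 1 ≤ ⟦ b ⟧ → b ≡ true
⟦⟧⁻ {true} _ = refl

⌊≟⌋-refl : ∀ {n} (i : Fin n) → ⌊ i ≟ i ⌋ ≡ true
⌊≟⌋-refl i with i ≟ i
... | yes _   = refl
... | no  i≢i = contradiction refl i≢i

⌊≟⌋-true : ∀ {n} {i j : Fin n} → ⌊ i ≟ j ⌋ ≡ true → i ≡ j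
⌊≟⌋-true {i = i} {j} e with i ≟ j
⌊≟⌋-true e  | yes i≡j = i≡j
⌊≟⌋-true () | no _

⌊≟⌋-false : ∀ {n} {i j : Fin n} → i ≢ j → ⌊ i ≟ j ⌋ ≡ false
⌊≟⌋-false {i = i} {j} i≢j with i ≟ j
... | yes i≡j = contradiction i≡j i≢j
... | no  _   = refl

true≢false : ∀ {b} → b ≡ true → b ≢ false
true≢false refl ()

-- Sums over Fin n

count≡sum : ∀ {n} (P : Fin n → Bool) → count P ≡ sum (λ i → ⟦ P i ⟧)
count≡sum P = trans (cong sumᴸ (map-tabulate (λ i → i) (λ i → ⟦ P i ⟧))) (sum-tabulate (λ i → ⟦ P i ⟧))
  where
  sum-tabulate : ∀ {n} (f : Fin n → ℕ) → sumᴸ (tabulate f) ≡ sum f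
  sum-tabulate {zero}  f = refl
  sum-tabulate {suc n} f = cong (f zero +_) (sum-tabulate (f ∘ suc))

sum-const : ∀ n k → sum {n} (λ _ → k) ≡ n * k
sum-const zero    k = refl
sum-const (suc n) k = cong (k +_) (sum-const n k)

sum-mono : ∀ {n} {f g : Fin n → ℕ} → (∀ i → f i ≤ g i) → sum f ≤ sum g
sum-mono {zero}  f≤g = z≤n
sum-mono {suc n} f≤g = +-mono-≤ (f≤g zero) (sum-mono (f≤g ∘ suc))

-- Turns equality in the global bound into equality at every vertex: slack in one term could not be
-- recovered by the others.
sum-squeeze : ∀ {n} {f g : Fin n → ℕ} → (∀ i → f i ≤ g i) → sum g ≤ sum f → ∀ i → f i ≡ g i
sum-squeeze {suc n} {f} {g} f≤g Σg≤Σf = λ where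
    zero    → ≤-antisym (f≤g zero) (+-cancelʳ-≤ (sum (g ∘ suc)) _ _
                (≤-trans Σg≤Σf (+-monoʳ-≤ (f zero) (sum-mono (f≤g ∘ suc)))))
    (suc i) → sum-squeeze (f≤g ∘ suc) (+-cancelˡ-≤ (f zero) _ _
                (≤-trans (+-monoˡ-≤ _ (f≤g zero)) Σg≤Σf)) i

1-term≤sum : ∀ {n} (f : Fin n → ℕ) i → f i ≤ sum f
1-term≤sum {suc n} f i = ≤-trans (m≤m+n (f i) _) (≤-reflexive (sym (sum-remove f)))

removeAt-punchOut : ∀ {n} (f : Fin (suc n) → ℕ) {i j} (i≢j : i ≢ j) → removeAt f i (punchOut i≢j) ≡ f j
removeAt-punchOut f i≢j = cong f (punchIn-punchOut i≢j)

2-terms≤sum : ∀ {n} (f : Fin n → ℕ) {i j} → i ≢ j → f i + f j ≤ sum f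
2-terms≤sum {suc n} f {i} {j} i≢j = begin
  f i + f j                                ≡⟨ cong (f i +_) (removeAt-punchOut f i≢j) ⟨
  f i + removeAt f i (punchOut i≢j)        ≤⟨ +-monoʳ-≤ (f i) (1-term≤sum (removeAt f i) _) ⟩
  f i + sum (removeAt f i)                 ≡⟨ sum-remove f ⟨
  sum f                                    ∎
  where open ≤-Reasoning

3-terms≤sum : ∀ {n} (f : Fin n → ℕ) {i j k} → i ≢ j → i ≢ k → j ≢ k → f i + (f j + f k) ≤ sum f
3-terms≤sum {suc n} f {i} {j} {k} i≢j i≢k j≢k = begin
  f i + (f j + f k)         ≡⟨ cong (f i +_) (cong₂ _+_ (removeAt-punchOut f i≢j) (removeAt-punchOut f i≢k)) ⟨
  f i + (removeAt f i (punchOut i≢j) + removeAt f i (punchOut i≢k))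
                            ≤⟨ +-monoʳ-≤ (f i) (2-terms≤sum (removeAt f i) (j≢k ∘ punchOut-injective i≢j i≢k)) ⟩
  f i + sum (removeAt f i)  ≡⟨ sum-remove f ⟨
  sum f                     ∎
  where open ≤-Reasoning

positive-term : ∀ {n} (f : Fin n → ℕ) → 1 ≤ sum f → ∃ λ i → 1 ≤ f i
positive-term {suc n} f 1≤Σ with f zero in eq
... | suc _ = zero , ≤-trans (s≤s z≤n) (≤-reflexive (sym eq))
... | zero  = let (i , p) = positive-term (f ∘ suc) 1≤Σ in suc i , p

other-positive-term : ∀ {n} (f : Fin n → ℕ) i → f i < sum f → ∃ λ j → j ≢ i × 1 ≤ f j
other-positive-term {suc n} f i fi<Σ =
  let (k , p) = positive-term (removeAt f i)
        (+-cancelˡ-≤ (f i) _ _ (≤-trans (≤-reflexive (+-comm (f i) 1)) (≤-trans fi<Σ (≤-reflexive (sum-remove f)))))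
  in punchIn i k , punchInᵢ≢i i k , p

sum-indicator : ∀ {n} (v : Fin n) → sum (λ i → ⟦ ⌊ i ≟ v ⌋ ⟧) ≡ 1
sum-indicator {suc n} v = begin
  sum (λ i → ⟦ ⌊ i ≟ v ⌋ ⟧)
    ≡⟨ sum-remove {i = v} (λ i → ⟦ ⌊ i ≟ v ⌋ ⟧) ⟩
  ⟦ ⌊ v ≟ v ⌋ ⟧ + sum (λ k → ⟦ ⌊ punchIn v k ≟ v ⌋ ⟧)
    ≡⟨ cong₂ _+_ (cong ⟦_⟧ (⌊≟⌋-refl v)) (sum-cong-≗ λ k → cong ⟦_⟧ (⌊≟⌋-false (punchInᵢ≢i v k))) ⟩
  1 + sum {n} (λ _ → 0)
    ≡⟨ cong suc (trans (sum-const n 0) (*-zeroʳ n)) ⟩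
  1 ∎
  where open ≡-Reasoning

-- Degrees, leaves, and the effect of adding a leaf

deg : ∀ {n} → Graph n → Fin n → ℕ
deg G v = sum (λ w → ⟦ G v w ⟧)

-- Degree 0 counts as a non-leaf, so that the values add up to `n ∸ leaves G` in every graph,
-- including `K1`.
nonLeaf : ℕ → ℕ
nonLeaf 1 = 0
nonLeaf _ = 1

nonLeaves : ∀ {n} → Graph n → ℕ
nonLeaves G = sum (λ v → nonLeaf (deg G v))

nonLeaves-leaves : ∀ {n} (G : Graph n) → n ∸ leaves G ≡ nonLeaves G
nonLeaves-leaves {n} G = begin
  n ∸ leaves G                          ≡⟨ cong (_∸ leaves G) total ⟨
  (nonLeaves G + leaves G) ∸ leaves G   ≡⟨ m+n∸n≡m (nonLeaves G) (leaves G) ⟩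
  nonLeaves G                           ∎
  where
  open ≡-Reasoning
  split : ∀ d → nonLeaf d + ⟦ ⌊ d ℕ.≟ 1 ⌋ ⟧ ≡ 1
  split 0             = refl
  split 1             = refl
  split (suc (suc d)) = refl
  total : nonLeaves G + leaves G ≡ n
  total = begin
    nonLeaves G + leaves G
      ≡⟨ cong (nonLeaves G +_) (count≡sum (isLeaf G)) ⟩
    nonLeaves G + sum (λ v → ⟦ isLeaf G v ⟧)
      ≡⟨ ∑-distrib-+ (λ v → nonLeaf (deg G v)) (λ v → ⟦ isLeaf G v ⟧) ⟨
    sum (λ v → nonLeaf (deg G v) + ⟦ isLeaf G v ⟧)
      ≡⟨ sum-cong-≗ (λ v → trans (cong (λ d → nonLeaf (deg G v) + ⟦ ⌊ d ℕ.≟ 1 ⌋ ⟧) (count≡sum (G v))) (split (deg G v))) ⟩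
    sum {n} (λ _ → 1)
      ≡⟨ trans (sum-const n 1) (*-identityʳ n) ⟩
    n ∎

-- Trees given by a construction sequence of leaf additions. Induction on the sequence yields the
-- degree sum and the paths between vertices.
data Built : ∀ {m} → Graph m → Set where
  root : Built K1
  leaf : ∀ {m} {H : Graph m} → Built H → ∀ v → Built (addLeaf H v)

sum-deg-Built : ∀ {m} {H : Graph m} → Built H → sum (deg H) + 2 ≡ 2 * m
sum-deg-Built root = refl
sum-deg-Built {suc m} (leaf {H = H} b v) = begin
  sum (λ j → ⟦ ⌊ j ≟ v ⌋ ⟧) + sum (λ i → ⟦ ⌊ i ≟ v ⌋ ⟧ + deg H i) + 2
    ≡⟨ cong (λ s → sum (λ j → ⟦ ⌊ j ≟ v ⌋ ⟧) + s + 2) (∑-distrib-+ (λ i → ⟦ ⌊ i ≟ v ⌋ ⟧) (deg H)) ⟩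
  sum (λ j → ⟦ ⌊ j ≟ v ⌋ ⟧) + (sum (λ i → ⟦ ⌊ i ≟ v ⌋ ⟧) + sum (deg H)) + 2
    ≡⟨ cong (λ s → s + (s + sum (deg H)) + 2) (sum-indicator v) ⟩
  2 + (sum (deg H) + 2)
    ≡⟨ cong (2 +_) (sum-deg-Built b) ⟩
  2 + 2 * m
    ≡⟨ *-suc 2 m ⟨
  2 * suc m ∎
  where open ≡-Reasoning

nonLeaves-addLeaf : ∀ {m} (H : Graph m) v →
  nonLeaves (addLeaf H v) ≡ sum (λ i → nonLeaf (⟦ ⌊ i ≟ v ⌋ ⟧ + deg H i))
nonLeaves-addLeaf H v = cong (λ s → nonLeaf s + sum (λ i → nonLeaf (⟦ ⌊ i ≟ v ⌋ ⟧ + deg H i))) (sum-indicator v)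

nonLeaves-addLeaf-internal : ∀ {m} (H : Graph m) v → 2 ≤ deg H v →
  nonLeaves (addLeaf H v) ≡ nonLeaves H
nonLeaves-addLeaf-internal H v 2≤d = trans (nonLeaves-addLeaf H v) (sum-cong-≗ same)
  where
  still : ∀ {d} → 2 ≤ d → nonLeaf (suc d) ≡ nonLeaf d
  still (s≤s (s≤s _)) = refl
  same : ∀ i → nonLeaf (⟦ ⌊ i ≟ v ⌋ ⟧ + deg H i) ≡ nonLeaf (deg H i)
  same i with i ≟ v
  ... | yes refl = still 2≤d
  ... | no _     = refl

nonLeaves-addLeaf-end : ∀ {m} (H : Graph m) v → deg H v ≡ 1 →
  nonLeaves (addLeaf H v) ≡ 1 + nonLeaves H
nonLeaves-addLeaf-end H v d≡1 = begin
  nonLeaves (addLeaf H v)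
    ≡⟨ nonLeaves-addLeaf H v ⟩
  sum (λ i → nonLeaf (⟦ ⌊ i ≟ v ⌋ ⟧ + deg H i))
    ≡⟨ sum-cong-≗ gain ⟩
  sum (λ i → ⟦ ⌊ i ≟ v ⌋ ⟧ + nonLeaf (deg H i))
    ≡⟨ ∑-distrib-+ (λ i → ⟦ ⌊ i ≟ v ⌋ ⟧) (λ i → nonLeaf (deg H i)) ⟩
  sum (λ i → ⟦ ⌊ i ≟ v ⌋ ⟧) + nonLeaves H
    ≡⟨ cong (_+ nonLeaves H) (sum-indicator v) ⟩
  1 + nonLeaves H ∎
  where
  open ≡-Reasoning
  gain : ∀ i → nonLeaf (⟦ ⌊ i ≟ v ⌋ ⟧ + deg H i) ≡ ⟦ ⌊ i ≟ v ⌋ ⟧ + nonLeaf (deg H i)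
  gain i with i ≟ v
  ... | yes refl rewrite d≡1 = refl
  ... | no _     = refl

-- Each of the five vertices is hung on a current leaf: first on `v`, then always on the vertex just
-- added. Every addition thus makes one old leaf internal and creates one new leaf.
nonLeaves-attachP5 : ∀ {m} (H : Graph m) v → deg H v ≡ 1 →
  nonLeaves (attachP5 H v) ≡ 5 + nonLeaves H
nonLeaves-attachP5 H v d≡1 =
  trans (prolong H₃ zero) (cong suc
  (trans (prolong H₂ zero) (cong suc
  (trans (prolong H₁ zero) (cong suc
  (trans (prolong H v) (cong suc
  (nonLeaves-addLeaf-end H v d≡1))))))))
  where
  H₁ = addLeaf H v
  H₂ = addLeaf H₁ zero
  H₃ = addLeaf H₂ zero
  prolong : ∀ {m} (K : Graph m) u → nonLeaves (addLeaf (addLeaf K u) zero) ≡ suc (nonLeaves (addLeaf K u))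
  prolong K u = nonLeaves-addLeaf-end (addLeaf K u) zero (sum-indicator u)

-- Growing induced subtrees

-- The list contains both endpoints, so `Unique` of it says that the path is simple.
data Path {m} (H : Graph m) : Fin m → Fin m → List (Fin m) → Set where
  stop : ∀ {i} → Path H i i (i ∷ [])
  step : ∀ {i k j xs} → Adj H i k → Path H k j xs → Path H i j (i ∷ xs)

SimplePath : ∀ {m} → Graph m → Fin m → Fin m → Set
SimplePath H i j = ∃ λ xs → Path H i j xs × Unique xs

mapPath : ∀ {m n} {H : Graph m} {G : Graph n} {f : Fin m → Fin n} →
  (∀ {i j} → Adj H i j → Adj G (f i) (f j)) →
  ∀ {i j xs} → Path H i j xs → Path G (f i) (f j) (map f xs)
mapPath hom stop       = stop
mapPath hom (step e p) = step (hom e) (mapPath hom p)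

snocPath : ∀ {m} {H : Graph m} {i j k xs} → Path H i j xs → Adj H j k → Path H i k (xs ++ k ∷ [])
snocPath stop       e = step e stop
snocPath (step d p) e = step d (snocPath p e)

Path⇒Linked : ∀ {m} {H : Graph m} {x a b y xs} → Adj H x a → Path H a b xs → Adj H b y →
  Linked (Adj H) (x ∷ xs ++ y ∷ [])
Path⇒Linked d stop       e = d ∷ e ∷ [-]
Path⇒Linked d (step c p) e = d ∷ Path⇒Linked c p e

Path-length : ∀ {m} {H : Graph m} {i j xs} → i ≢ j → Path H i j xs → 2 ≤ length xs
Path-length i≢j stop                  = contradiction refl i≢j
Path-length _   (step _ stop)         = s≤s (s≤s z≤n)
Path-length _   (step _ (step _ _))   = s≤s (s≤s z≤n)

-- The vertex added last is a leaf, so it is only ever needed as an endpoint: prepend or append it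
-- to a path of the smaller tree, whose vertices all lie in the image of `suc`.
simplePath : ∀ {m} {H : Graph m} → Built H → ∀ i j → SimplePath H i j
simplePath root zero zero = _ , stop , [] ∷ []
simplePath (leaf b v) zero zero = _ , stop , [] ∷ []
simplePath (leaf b v) zero (suc j) =
  let (xs , p , u) = simplePath b v j in
  zero ∷ map suc xs , step (⌊≟⌋-refl v) (mapPath (λ e → e) p) ,
  All.map⁺ (universal (λ _ ()) xs) ∷ Unique.map⁺ suc-injective u
simplePath (leaf b v) (suc i) zero =
  let (xs , p , u) = simplePath b i v in
  map suc xs ++ zero ∷ [] , snocPath (mapPath (λ e → e) p) (⌊≟⌋-refl v) ,
  Unique.++⁺ (Unique.map⁺ suc-injective u) ([] ∷ [])
    λ { (x∈ , here refl) → let (_ , _ , 0≡suc) = ∈-map⁻ suc x∈ in contradiction 0≡suc λ () }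
simplePath (leaf b v) (suc i) (suc j) =
  let (xs , p , u) = simplePath b i j in
  map suc xs , mapPath (λ e → e) p , Unique.map⁺ suc-injective u

record Embedding {m n} (H : Graph m) (G : Graph n) (f : Fin m → Fin n) : Set where
  field
    induced   : ∀ i j → G (f i) (f j) ≡ H i j
    injective : Injective _≡_ _≡_ f

open Embedding

Fresh : ∀ {m n} → (Fin m → Fin n) → Fin n → Set
Fresh f y = ∀ i → f i ≢ y

crossing : ∀ {n} {G : Graph n} {P : Fin n → Set} → Decidable P →
  ∀ {u v} xs → Linked (Adj G) (u ∷ xs ++ v ∷ []) → P u → ¬ P v →
  ∃₂ λ x y → P x × ¬ P y × Adj G x y
crossing P? []       (e ∷ _) Pu ¬Pv = _ , _ , Pu , ¬Pv , e
crossing P? (w ∷ xs) (e ∷ l) Pu ¬Pv with P? w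
... | yes Pw = crossing P? xs l Pw ¬Pv
... | no ¬Pw = _ , _ , Pu , ¬Pw , e

Surjection : ∀ {m n} → (Fin m → Fin n) → Set
Surjection f = ∀ y → ∃ λ i → f i ≡ y

-- The growth loop is shared: with `P` saying "induced built tree" it gives the degree sum, with `P`
-- saying "induced labelled copy of a member of 𝒯" it gives membership in the family. One
-- enlargement may add several vertices, hence `m ≤ m′`.
module Growth {n} {G : Graph n} (connected : Connected G)
  (P : ∀ m → (Fin m → Fin n) → Set)
  (P-injective : ∀ {m f} → P m f → Injective _≡_ _≡_ f)
  (enlarge : ∀ {m f} → P m f → ∀ {i y} → Fresh f y → Adj G (f i) y →
             ∃₂ λ m′ f′ → m ≤ m′ × P (suc m′) f′)
  where

  grow : ∀ fuel {m f} → n ≤ m + fuel → P (suc m) f → ∃₂ λ m f → P m f × Surjection f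
  grow fuel {m} {f} n≤ p with all? (λ y → any? (λ i → f i ≟ y))
  ... | yes onto = _ , f , p , onto
  ... | no ¬onto = continue fuel n≤
    where
    hit? : Decidable (λ y → ∃ λ i → f i ≡ y)
    hit? y = any? (λ i → f i ≟ y)

    larger : ∃₂ λ m′ f′ → suc m ≤ m′ × P (suc m′) f′
    larger =
      let (y , y∉) = ¬∀⟶∃¬ n _ hit? ¬onto
          (xs , l) = connected (f zero) y (λ e → y∉ (zero , e))
      in enlargeAt (crossing hit? xs l (zero , refl) y∉)
      where
      enlargeAt : (∃₂ λ x y → (∃ λ i → f i ≡ x) × ¬ (∃ λ i → f i ≡ y) × Adj G x y) → _
      enlargeAt (_ , y , (i , refl) , y∉ , e) = enlarge p (λ i fi≡y → y∉ (i , fi≡y)) e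

    continue : ∀ fuel → n ≤ m + fuel → ∃₂ λ m f → P m f × Surjection f
    -- The map `f` has domain `Fin (suc m)`, so injectivity gives `suc m ≤ n`, whereas exhausted
    -- fuel means `n ≤ m`.
    continue zero n≤ = contradiction
      (≤-trans (injective⇒≤ (P-injective p)) (≤-trans n≤ (≤-reflexive (+-identityʳ m)))) 1+n≰n
    continue (suc fuel) n≤ =
      let (m′ , _ , m<m′ , p′) = larger in
      grow fuel (≤-trans n≤ (≤-trans (≤-reflexive (+-suc m fuel)) (+-monoˡ-≤ fuel m<m′))) p′

module Tree {n} {G : Graph n} (tree : IsTree G) where
  open IsTree tree

  Adj-sym : ∀ {u v} → Adj G u v → Adj G v u
  Adj-sym {u} {v} e = trans (symmetric v u) e

  Adj-irrefl : ∀ {u v} → Adj G u v → u ≢ v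
  Adj-irrefl {u} e refl = true≢false e (irreflexive u)

  -- A second neighbour of y in the connected image would close a cycle through y.
  extend : ∀ {m} {H : Graph m} {f : Fin m → Fin n} {y v} → Built H → Embedding H G f →
    Fresh f y → Adj G (f v) y → Embedding (addLeaf H v) G (y ◂ f)
  extend {m} {H} {f} {y} {v} b e y∉ fv~y = record { induced = ind ; injective = inj _ _ }
    where
    only : ∀ j → G y (f j) ≡ ⌊ j ≟ v ⌋
    only j with j ≟ v
    ... | yes refl = Adj-sym fv~y
    ... | no j≢v with G y (f j) in y~fj
    ...   | false = refl
    ...   | true  =
      let (xs , p , u) = simplePath b j v
          p′ = mapPath (λ {i} {j} d → trans (induced e i j) d) p
      in contradiction
           (y , map f xs , Path-length (j≢v ∘ injective e) p′ ,
            All.map⁺ (universal (λ i → y∉ i ∘ sym) xs) ∷ Unique.map⁺ (injective e) u ,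
            Path⇒Linked y~fj p′ fv~y)
           acyclic
    ind : ∀ i j → G ((y ◂ f) i) ((y ◂ f) j) ≡ addLeaf H v i j
    ind zero    zero    = irreflexive y
    ind zero    (suc j) = only j
    ind (suc i) zero    = trans (symmetric (f i) y) (only i)
    ind (suc i) (suc j) = induced e i j
    inj : ∀ i j → (y ◂ f) i ≡ (y ◂ f) j → i ≡ j
    inj zero    zero    _   = refl
    inj zero    (suc j) y≡  = contradiction (sym y≡) (y∉ j)
    inj (suc i) zero    ≡y  = contradiction ≡y (y∉ i)
    inj (suc i) (suc j) eq  = cong suc (injective e eq)

  -- The vertex `zero` is a leaf of the induced copy, with `suc v` as its only neighbour there. Any
  -- other neighbour of its image must lie outside the copy.
  fresh : ∀ {m} {H : Graph m} {f : Fin (suc m) → Fin n} {v w} → Embedding (addLeaf H v) G f →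
    Adj G (f zero) w → w ≢ f (suc v) → Fresh f w
  fresh e f0~w w≢ zero    refl = Adj-irrefl f0~w refl
  fresh {f = f} e f0~w w≢ (suc j) refl =
    w≢ (cong (f ∘ suc) (⌊≟⌋-true (trans (sym (induced e zero (suc j))) f0~w)))

  single : ∀ v → Embedding K1 G (λ _ → v)
  single v = record { induced = λ _ _ → irreflexive v ; injective = λ { {zero} {zero} _ → refl } }

-- Isomorphism invariance and the degree sum of a tree

module Iso {m n} {H : Graph m} {G : Graph n} (π : Permutation m n)
  (iso : ∀ u v → G (π ⟨$⟩ʳ u) (π ⟨$⟩ʳ v) ≡ H u v) where

  deg-iso : ∀ u → deg G (π ⟨$⟩ʳ u) ≡ deg H u
  deg-iso u = trans (sum-permute (λ w → ⟦ G (π ⟨$⟩ʳ u) w ⟧) π) (sum-cong-≗ (λ v → cong ⟦_⟧ (iso u v)))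

  sum-deg-iso : (h : ℕ → ℕ) → sum (λ v → h (deg G v)) ≡ sum (λ u → h (deg H u))
  sum-deg-iso h = trans (sum-permute (λ v → h (deg G v)) π) (sum-cong-≗ (λ u → cong h (deg-iso u)))

surjection⇒permutation : ∀ {m n} {f : Fin m → Fin n} → Injective _≡_ _≡_ f → Surjection f →
  Σ (Permutation m n) λ π → ∀ i → π ⟨$⟩ʳ i ≡ f i
surjection⇒permutation {f = f} inj onto =
  permutation f (proj₁ ∘ onto) (proj₂ ∘ onto) (λ i → inj (proj₂ (onto (f i)))) , λ _ → refl

-- A built subtree grown from `r` ends up covering the tree, so `G` is isomorphic to a built graph
-- and inherits its degree sum.
sum-deg-tree : ∀ {n} {G : Graph n} → IsTree G → Fin n → sum (deg G) + 2 ≡ 2 * n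
sum-deg-tree {n} {G} tree r
  with Growth.grow (IsTree.connected tree) IsBuilt (λ (_ , _ , e) → injective e) enlarge n ≤-refl
         (K1 , root , Tree.single tree r)
  where
  IsBuilt : ∀ m → (Fin m → Fin n) → Set
  IsBuilt m f = Σ (Graph m) λ H → Built H × Embedding H G f
  enlarge : ∀ {m f} → IsBuilt m f → ∀ {i y} → Fresh f y → Adj G (f i) y →
            ∃₂ λ m′ f′ → m ≤ m′ × IsBuilt (suc m′) f′
  enlarge (H , b , e) {i} y∉ a = _ , _ , ≤-refl , addLeaf H i , leaf b i , Tree.extend tree b e y∉ a
... | m , f , (H , b , e) , onto with surjection⇒permutation (injective e) onto
... | π , π≡f with ↔⇒≡ π
... | refl = trans (cong (_+ 2) (Iso.sum-deg-iso π iso (λ d → d))) (sum-deg-Built b)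
  where
  iso : ∀ u v → G (π ⟨$⟩ʳ u) (π ⟨$⟩ʳ v) ≡ H u v
  iso u v = trans (cong₂ G (π≡f u) (π≡f v)) (induced e u v)

-- The discharging argument

-- The balance of a vertex outside `D` with degree `d` and `m` neighbours in `D`. The need is 4 for
-- a leaf and 6 otherwise. For `m` equal to 1 or 2 the gifts amount to 2, which suffices; for
-- `m ≥ 3` there are no gifts, but already `2 * d ≥ 6`.
outside-balance : ∀ {m d} → 1 ≤ m → m ≤ d → 2 * nonLeaf d + 4 ≤ m * (3 ∸ m) + 2 * d
outside-balance {1} {1} _ _ = ≤-refl
outside-balance {1} {suc (suc d)} _ _ = +-monoʳ-≤ 2 (*-monoʳ-≤ 2 {2} (s≤s (s≤s z≤n)))
outside-balance {2} {suc (suc d)} _ _ = +-monoʳ-≤ 2 (*-monoʳ-≤ 2 {2} (s≤s (s≤s z≤n)))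
outside-balance {2} {1} _ (s≤s ())
outside-balance {suc (suc (suc m))} {suc (suc (suc d))} _ _ =
  ≤-trans (*-monoʳ-≤ 2 {3} {3 + d} (s≤s (s≤s (s≤s z≤n)))) (m≤n+m _ ((3 + m) * (0 ∸ m)))
outside-balance {suc (suc (suc m))} {1} _ (s≤s ())
outside-balance {suc (suc (suc m))} {2} _ (s≤s (s≤s ()))

-- For a non-leaf the equation reads 6 = 2 + 2d, hence `d` is 2.
outside-balance-tight : ∀ {m d} → 1 ≤ m → m ≤ 2 → 2 * nonLeaf d + 4 ≡ m * (3 ∸ m) + 2 * d → d ≤ 2
outside-balance-tight {d = 0} _ _ _ = z≤n
outside-balance-tight {d = 1} _ _ _ = s≤s z≤n
outside-balance-tight {1} {suc (suc d)} _ _ eq = *-cancelˡ-≤ 2 (≤-reflexive (sym (+-cancelˡ-≡ 2 4 _ eq)))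
outside-balance-tight {2} {suc (suc d)} _ _ eq = *-cancelˡ-≤ 2 (≤-reflexive (sym (+-cancelˡ-≡ 2 4 _ eq)))
outside-balance-tight {suc (suc (suc m))} _ (s≤s (s≤s ())) _

-- The interface between the two halves of the forward direction: tight discharging produces it, the
-- growth of a member of 𝒯 consumes it, and `D` is no longer mentioned.
record Patterned {n} (G : Graph n) (S : Labeling n) : Set where
  field
    A-A-free   : ∀ {a v} → S a ≡ A → Adj G a v → S v ≢ A
    A-B        : ∀ {a} → S a ≡ A → ∃ λ b → Adj G a b × S b ≡ B
    A-B-unique : ∀ {a b b′} → S a ≡ A → Adj G a b → S b ≡ B → Adj G a b′ → S b′ ≡ B → b ≡ b′
    A-C        : ∀ {a} → S a ≡ A → ∃ λ c → Adj G a c × S c ≡ C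
    B-A        : ∀ {b v} → S b ≡ B → Adj G b v → S v ≡ A
    B-second   : ∀ {b a} → S b ≡ B → Adj G b a → ∃ λ a′ → Adj G b a′ × a′ ≢ a
    B-no-third : ∀ {b x y z} → S b ≡ B → Adj G b x → Adj G b y → Adj G b z →
                 x ≢ y → x ≢ z → y ≢ z → ⊥
    C-A        : ∀ {c} → S c ≡ C → ∃ λ a → Adj G c a × S a ≡ A
    C-A-unique : ∀ {c a a′} → S c ≡ C → Adj G c a → S a ≡ A → Adj G c a′ → S a′ ≡ A → a ≡ a′
    C-C-unique : ∀ {c x y} → S c ≡ C → Adj G c x → S x ≢ A → Adj G c y → S y ≢ A → x ≡ y

module Discharging {n} {G : Graph n} (tree : IsTree G) {D : VSet n}
  (std : IsSemitotalDominating G D) where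

  open IsTree tree using (symmetric)
  open Tree tree using (Adj-sym; Adj-irrefl)
  open IsSemitotalDominating std

  domDeg : Fin n → ℕ
  domDeg w = sum (λ u → ⟦ D u ⟧ * ⟦ G w u ⟧)

  -- Each vertex of D gives 3 ∸ domDeg w to each of its neighbours w outside D,
  -- which makes w receive 2, 2, 0, 0, … according to domDeg w = 1, 2, 3, 4, …
  gift : Fin n → ℕ
  gift w = if D w then 0 else 3 ∸ domDeg w

  -- A vertex of `D` gives at most 2 along an edge, since each of its neighbours has `domDeg` at
  -- least 1. The saving is what remains of these 2.
  saving : Fin n → ℕ
  saving w = 2 ∸ gift w

  saved : Fin n → ℕ
  saved v = sum (λ w → ⟦ G v w ⟧ * saving w)

  given : Fin n → ℕ
  given v = ⟦ D v ⟧ * sum (λ w → ⟦ G v w ⟧ * gift w)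

  -- The local charge after the gifts, with its negative terms in `debit` and its positive terms in
  -- `credit`, so that no subtraction in `ℕ` occurs. The first summands are the gifts made and the
  -- gifts received.
  debit credit : Fin n → ℕ
  debit  v = given v + (2 * nonLeaf (deg G v) + 4)
  credit v = domDeg v * gift v + (5 * ⟦ D v ⟧ + 2 * deg G v)

  gift-D : ∀ {w} → D w ≡ true → gift w ≡ 0
  gift-D Dw rewrite Dw = refl

  saving-D : ∀ {w} → D w ≡ true → saving w ≡ 2
  saving-D Dw rewrite Dw = refl

  saving-nonD : ∀ {w} → D w ≡ false → saving w ≡ 2 ∸ (3 ∸ domDeg w)
  saving-nonD Dw rewrite Dw = refl

  domDeg-term : ∀ {v u} → D u ≡ true → Adj G v u → ⟦ D u ⟧ * ⟦ G v u ⟧ ≡ 1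
  domDeg-term Du e rewrite Du | e = refl

  domDeg-term⁻ : ∀ {v u} → 1 ≤ ⟦ D u ⟧ * ⟦ G v u ⟧ → D u ≡ true × Adj G v u
  domDeg-term⁻ {v} {u} 1≤ with D u | G v u
  domDeg-term⁻ _  | true  | true  = refl , refl
  domDeg-term⁻ () | true  | false
  domDeg-term⁻ () | false | _

  domDeg≥1 : ∀ {v u} → D u ≡ true → Adj G v u → 1 ≤ domDeg v
  domDeg≥1 {v} {u} Du e = subst (_≤ domDeg v) (domDeg-term Du e) (1-term≤sum (λ u → ⟦ D u ⟧ * ⟦ G v u ⟧) u)

  domDeg≥2 : ∀ {v x y} → D x ≡ true → Adj G v x → D y ≡ true → Adj G v y → x ≢ y → 2 ≤ domDeg v
  domDeg≥2 {v} Dx v~x Dy v~y x≢y =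
    subst₂ (λ a b → a + b ≤ domDeg v) (domDeg-term Dx v~x) (domDeg-term Dy v~y)
      (2-terms≤sum (λ u → ⟦ D u ⟧ * ⟦ G v u ⟧) x≢y)

  saved-term : ∀ {v w} → Adj G v w → ⟦ G v w ⟧ * saving w ≡ saving w
  saved-term {w = w} e rewrite e = +-identityʳ (saving w)

  saving≤saved : ∀ {v w} → Adj G v w → saving w ≤ saved v
  saving≤saved {v} {w} e = subst (_≤ saved v) (saved-term e) (1-term≤sum (λ w → ⟦ G v w ⟧ * saving w) w)

  2-savings≤saved : ∀ {v x y} → Adj G v x → Adj G v y → x ≢ y → saving x + saving y ≤ saved v
  2-savings≤saved {v} v~x v~y x≢y =
    subst₂ (λ a b → a + b ≤ saved v) (saved-term v~x) (saved-term v~y)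
      (2-terms≤sum (λ w → ⟦ G v w ⟧ * saving w) x≢y)

  saving≥1 : ∀ {w} → 2 ≤ domDeg w → 1 ≤ saving w
  saving≥1 {w} 2≤ with D w
  ... | true  = s≤s z≤n
  ... | false = ∸-monoʳ-≤ 2 (∸-monoʳ-≤ 3 2≤)

  -- Semitotality enters here. A neighbour in `D` receives nothing and saves 2; otherwise the middle
  -- vertex of a path of length two to another vertex of `D` has two neighbours in `D` and saves at
  -- least 1.
  saved≥1 : ∀ {v} → D v ≡ true → 1 ≤ saved v
  saved≥1 {v} Dv with semitotal v Dv
  ... | u , Du , _ , inj₁ u~v =
    ≤-trans (≤-trans (s≤s z≤n) (≤-reflexive (sym (saving-D Du)))) (saving≤saved (Adj-sym u~v))
  ... | u , Du , u≢v , inj₂ (w , u~w , w~v) =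
    ≤-trans (saving≥1 (domDeg≥2 Du (Adj-sym u~w) Dv w~v u≢v)) (saving≤saved (Adj-sym w~v))

  gift≤2 : ∀ {v w} → D v ≡ true → Adj G v w → gift w ≤ 2
  gift≤2 {v} {w} Dv e with D w
  ... | true  = z≤n
  ... | false = ∸-monoʳ-≤ 3 (domDeg≥1 Dv (Adj-sym e))

  given+saved : ∀ {v} → D v ≡ true → given v + saved v ≡ 2 * deg G v
  given+saved {v} Dv = begin
    given v + saved v
      ≡⟨ cong (λ b → ⟦ b ⟧ * sum (λ w → ⟦ G v w ⟧ * gift w) + saved v) Dv ⟩
    1 * sum (λ w → ⟦ G v w ⟧ * gift w) + saved v
      ≡⟨ cong (_+ saved v) (*-identityˡ _) ⟩
    sum (λ w → ⟦ G v w ⟧ * gift w) + saved v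
      ≡⟨ ∑-distrib-+ (λ w → ⟦ G v w ⟧ * gift w) (λ w → ⟦ G v w ⟧ * saving w) ⟨
    sum (λ w → ⟦ G v w ⟧ * gift w + ⟦ G v w ⟧ * saving w)
      ≡⟨ sum-cong-≗ termwise ⟩
    sum (λ w → 2 * ⟦ G v w ⟧)
      ≡⟨ *-distribˡ-sum 2 (λ w → ⟦ G v w ⟧) ⟨
    2 * deg G v ∎
    where
    open ≡-Reasoning
    termwise : ∀ w → ⟦ G v w ⟧ * gift w + ⟦ G v w ⟧ * saving w ≡ 2 * ⟦ G v w ⟧
    termwise w with G v w in e
    ... | false = refl
    ... | true  = trans (cong₂ _+_ (+-identityʳ (gift w)) (+-identityʳ (saving w))) (m+[n∸m]≡n (gift≤2 Dv e))

  credit-D : ∀ {v} → D v ≡ true → credit v ≡ given v + (5 + saved v)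
  credit-D {v} Dv = begin
    domDeg v * gift v + (5 * ⟦ D v ⟧ + 2 * deg G v)
      ≡⟨ cong₂ _+_ (trans (cong (domDeg v *_) (gift-D Dv)) (*-zeroʳ (domDeg v)))
                   (cong₂ (λ b d → 5 * ⟦ b ⟧ + d) Dv (sym (given+saved Dv))) ⟩
    5 + (given v + saved v)
      ≡⟨ shift 5 (given v) (saved v) ⟩
    given v + (5 + saved v) ∎
    where
    open ≡-Reasoning
    shift : ∀ a b c → a + (b + c) ≡ b + (a + c)
    shift = solve-∀

  debit-nonD : ∀ {v} → D v ≡ false → debit v ≡ 2 * nonLeaf (deg G v) + 4
  debit-nonD Dv rewrite Dv = refl

  credit-nonD : ∀ {v} → D v ≡ false → credit v ≡ domDeg v * (3 ∸ domDeg v) + 2 * deg G v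
  credit-nonD Dv rewrite Dv = refl

  nonLeaf≤1 : ∀ d → nonLeaf d ≤ 1
  nonLeaf≤1 0             = ≤-refl
  nonLeaf≤1 1             = z≤n
  nonLeaf≤1 (suc (suc d)) = ≤-refl

  dominated : ∀ {v} → D v ≡ false → ∃ λ u → D u ≡ true × Adj G v u
  dominated {v} Dv = let (u , Du , e) = dominating v Dv in u , Du , Adj-sym e

  domDeg≤deg : ∀ v → domDeg v ≤ deg G v
  domDeg≤deg v = sum-mono λ u → bound (D u) ⟦ G v u ⟧
    where
    bound : ∀ b k → ⟦ b ⟧ * k ≤ k
    bound true  k = ≤-reflexive (*-identityˡ k)
    bound false k = z≤n

  D-or-not : ∀ v → D v ≡ true ⊎ D v ≡ false
  D-or-not v with D v
  ... | true  = inj₁ refl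
  ... | false = inj₂ refl

  -- In `D`, after cancelling the gifts made, at most 2 + 4 is compared with 5 plus a saved amount
  -- of at least 1. Outside `D`, this is `outside-balance`.
  debit≤credit : ∀ v → debit v ≤ credit v
  debit≤credit v with D-or-not v
  ... | inj₁ Dv = ≤-trans
    (+-monoʳ-≤ (given v) (+-mono-≤ (*-monoʳ-≤ 2 (nonLeaf≤1 (deg G v))) (+-monoʳ-≤ 4 z≤n)))
    (≤-trans (+-monoʳ-≤ (given v) (+-monoʳ-≤ 5 (saved≥1 Dv))) (≤-reflexive (sym (credit-D Dv))))
  ... | inj₂ Dv =
    let (_ , Du , e) = dominated Dv in
    subst₂ _≤_ (sym (debit-nonD Dv)) (sym (credit-nonD Dv))
      (outside-balance (domDeg≥1 Du e) (domDeg≤deg v))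

  -- Double counting: the gifts are added up by giver and by receiver, which agree because adjacency
  -- is symmetric.
  sum-given : sum given ≡ sum (λ w → domDeg w * gift w)
  sum-given = begin
    sum (λ v → ⟦ D v ⟧ * sum (λ w → ⟦ G v w ⟧ * gift w))
      ≡⟨ sum-cong-≗ (λ v → *-distribˡ-sum ⟦ D v ⟧ (λ w → ⟦ G v w ⟧ * gift w)) ⟩
    sum (λ v → sum (λ w → ⟦ D v ⟧ * (⟦ G v w ⟧ * gift w)))
      ≡⟨ ∑-comm (λ v w → ⟦ D v ⟧ * (⟦ G v w ⟧ * gift w)) ⟩
    sum (λ w → sum (λ v → ⟦ D v ⟧ * (⟦ G v w ⟧ * gift w)))
      ≡⟨ sum-cong-≗ (λ w → sum-cong-≗ (λ v → trans (sym (*-assoc ⟦ D v ⟧ _ _))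
           (cong (λ b → ⟦ D v ⟧ * ⟦ b ⟧ * gift w) (symmetric v w)))) ⟩
    sum (λ w → sum (λ v → ⟦ D v ⟧ * ⟦ G w v ⟧ * gift w))
      ≡⟨ sum-cong-≗ (λ w → *-distribʳ-sum (gift w) (λ v → ⟦ D v ⟧ * ⟦ G w v ⟧)) ⟨
    sum (λ w → domDeg w * gift w) ∎
    where open ≡-Reasoning

  private
    -- Here `E` is the degree sum, twice the number of edges.
    N K E : ℕ
    N = nonLeaves G
    K = sum (λ v → ⟦ D v ⟧)
    E = sum (deg G)

  sum-debit : sum debit ≡ sum given + (2 * N + n * 4)
  sum-debit = trans (∑-distrib-+ given (λ v → 2 * nonLeaf (deg G v) + 4))
    (cong (sum given +_) (trans (∑-distrib-+ (λ v → 2 * nonLeaf (deg G v)) (λ _ → 4))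
      (cong₂ _+_ (sym (*-distribˡ-sum 2 (λ v → nonLeaf (deg G v)))) (sum-const n 4))))

  sum-credit : sum credit ≡ sum given + (5 * K + 2 * E)
  sum-credit = trans (∑-distrib-+ (λ v → domDeg v * gift v) (λ v → 5 * ⟦ D v ⟧ + 2 * deg G v))
    (cong₂ _+_ (sym sum-given) (trans (∑-distrib-+ (λ v → 5 * ⟦ D v ⟧) (λ v → 2 * deg G v))
      (cong₂ _+_ (sym (*-distribˡ-sum 5 (λ v → ⟦ D v ⟧))) (sym (*-distribˡ-sum 2 (deg G))))))

  -- The gifts cancel globally. Since `2 * (E + 2)` equals 4n, the degrees pay the 4 charged to each
  -- vertex up to a defect of 4, which is the constant part of `2 * (N + 2)`.
  balance : Fin n → sum credit + 2 * (N + 2) ≡ sum debit + 5 * K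
  balance r = begin
    sum credit + 2 * (N + 2)
      ≡⟨ cong (_+ 2 * (N + 2)) sum-credit ⟩
    sum given + (5 * K + 2 * E) + 2 * (N + 2)
      ≡⟨ collect (sum given) K E N ⟩
    sum given + (2 * N + 2 * (E + 2)) + 5 * K
      ≡⟨ cong (λ s → sum given + (2 * N + 2 * s) + 5 * K) (sum-deg-tree tree r) ⟩
    sum given + (2 * N + 2 * (2 * n)) + 5 * K
      ≡⟨ cong (λ s → sum given + (2 * N + s) + 5 * K) (fourfold n) ⟩
    sum given + (2 * N + n * 4) + 5 * K
      ≡⟨ cong (_+ 5 * K) sum-debit ⟨
    sum debit + 5 * K ∎
    where
    open ≡-Reasoning
    collect : ∀ x k e m → x + (5 * k + 2 * e) + 2 * (m + 2) ≡ x + (2 * m + 2 * (e + 2)) + 5 * k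
    collect = solve-∀
    fourfold : ∀ m → 2 * (2 * m) ≡ m * 4
    fourfold = solve-∀

  lower-bound : Fin n → 2 * (N + 2) ≤ 5 * K
  lower-bound r = +-cancelˡ-≤ (sum debit) _ _
    (≤-trans (+-monoˡ-≤ _ (sum-mono debit≤credit)) (≤-reflexive (balance r)))

  -- Local consequences of equality

  module Tight (r : Fin n) (tight : 5 * K ≡ 2 * (N + 2)) where

    debit≡credit : ∀ v → debit v ≡ credit v
    debit≡credit = sum-squeeze debit≤credit (≤-reflexive (+-cancelʳ-≡ (5 * K) _ _
      (trans (cong (sum credit +_) tight) (balance r))))

    -- Once `given v` is cancelled, a left side of at most 6 equals a right side of at least 6, so
    -- both estimates used in `debit≤credit` are equalities.
    D-tight : ∀ {v} → D v ≡ true → nonLeaf (deg G v) ≡ 1 × saved v ≡ 1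
    D-tight {v} Dv = solve (nonLeaf≤1 (deg G v)) (saved≥1 Dv)
        (+-cancelˡ-≡ (given v) _ _ (trans (debit≡credit v) (credit-D Dv)))
      where
      solve : ∀ {x s} → x ≤ 1 → 1 ≤ s → 2 * x + 4 ≡ 5 + s → x ≡ 1 × s ≡ 1
      solve {0} _ _ ()
      solve {1} _ _ refl = refl , refl
      solve {suc (suc _)} (s≤s ()) _ _

    saving≤1 : ∀ {v w} → D v ≡ true → Adj G v w → saving w ≤ 1
    saving≤1 Dv e = subst (_ ≤_) (proj₂ (D-tight Dv)) (saving≤saved e)

    -- A neighbour in `D` would save 2, but the total saved is 1.
    D-nbr : ∀ {v w} → D v ≡ true → Adj G v w → D w ≡ false
    D-nbr {v} {w} Dv e with D-or-not w
    ... | inj₂ Dw = Dw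
    ... | inj₁ Dw = contradiction (subst (_≤ 1) (saving-D Dw) (saving≤1 Dv e)) λ { (s≤s ()) }

    -- With three or more neighbours in `D`, `w` would receive no gift and save 2 for each of them.
    domDeg≤2 : ∀ {w} → D w ≡ false → domDeg w ≤ 2
    domDeg≤2 {w} Dw = bound (domDeg w) refl
      where
      bound : ∀ m → domDeg w ≡ m → domDeg w ≤ 2
      bound 0 eq = subst (_≤ 2) (sym eq) z≤n
      bound 1 eq = subst (_≤ 2) (sym eq) (s≤s z≤n)
      bound 2 eq = ≤-reflexive eq
      bound (suc (suc (suc m))) eq =
        let (_ , Du , e) = dominated Dw in
        contradiction (saving≤1 Du (Adj-sym e))
          (λ ≤1 → 1+n≰n (subst (_≤ 1) (trans (saving-nonD Dw)
            (trans (cong (λ m → 2 ∸ (3 ∸ m)) eq) (cong (2 ∸_) (0∸n≡0 m)))) ≤1))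

    deg≤2 : ∀ {v} → D v ≡ false → deg G v ≤ 2
    deg≤2 {v} Dv =
      let (_ , Du , e) = dominated Dv in
      outside-balance-tight (domDeg≥1 Du e) (domDeg≤2 Dv)
        (trans (sym (debit-nonD Dv)) (trans (debit≡credit v) (credit-nonD Dv)))

    no-3-neighbours : ∀ {v x y z} → D v ≡ false → Adj G v x → Adj G v y → Adj G v z →
      x ≢ y → x ≢ z → y ≢ z → ⊥
    no-3-neighbours {v} Dv v~x v~y v~z x≢y x≢z y≢z = 1+n≰n (≤-trans
      (subst (_≤ deg G v) (cong₂ (λ a b → ⟦ a ⟧ + b) v~x (cong₂ (λ a b → ⟦ a ⟧ + ⟦ b ⟧) v~y v~z))
        (3-terms≤sum (λ w → ⟦ G v w ⟧) x≢y x≢z y≢z)) (deg≤2 Dv))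

    label : Labeling n
    label v = if D v then A else (if ⌊ domDeg v ℕ.≟ 2 ⌋ then B else C)

    label-A⁻ : ∀ {v} → label v ≡ A → D v ≡ true
    label-A⁻ {v} eq with D v | ⌊ domDeg v ℕ.≟ 2 ⌋
    label-A⁻ _  | true  | _     = refl
    label-A⁻ () | false | true
    label-A⁻ () | false | false

    label-B⁻ : ∀ {v} → label v ≡ B → D v ≡ false × domDeg v ≡ 2
    label-B⁻ {v} eq with D v | domDeg v ℕ.≟ 2
    label-B⁻ () | true  | _
    label-B⁻ _  | false | yes m≡2 = refl , m≡2
    label-B⁻ () | false | no _

    label-C⁻ : ∀ {v} → label v ≡ C → D v ≡ false × domDeg v ≢ 2
    label-C⁻ {v} eq with D v | domDeg v ℕ.≟ 2
    label-C⁻ () | true  | _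
    label-C⁻ () | false | yes _
    label-C⁻ _  | false | no m≢2 = refl , m≢2

    label-A : ∀ {v} → D v ≡ true → label v ≡ A
    label-A Dv rewrite Dv = refl

    label-B : ∀ {v} → D v ≡ false → domDeg v ≡ 2 → label v ≡ B
    label-B Dv m≡2 rewrite Dv | m≡2 = refl

    label-C : ∀ {v} → D v ≡ false → domDeg v ≢ 2 → label v ≡ C
    label-C {v} Dv m≢2 with D v | domDeg v ℕ.≟ 2
    label-C () _   | true  | _
    label-C _  m≢2 | false | yes m≡2 = contradiction m≡2 m≢2
    label-C _  _   | false | no _    = refl

    second-D-neighbour : ∀ {v u} → 2 ≤ domDeg v → D u ≡ true → Adj G v u →
      ∃ λ u′ → u′ ≢ u × D u′ ≡ true × Adj G v u′
    second-D-neighbour {v} {u} 2≤ Du e =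
      let (u′ , u′≢u , 1≤) = other-positive-term (λ u → ⟦ D u ⟧ * ⟦ G v u ⟧) u
            (subst (_< domDeg v) (sym (domDeg-term Du e)) 2≤)
      in u′ , u′≢u , domDeg-term⁻ 1≤

    saving≥1⁻ : ∀ {w} → D w ≡ false → 1 ≤ saving w → domDeg w ≡ 2
    saving≥1⁻ {w} Dw 1≤ = ≤-antisym (domDeg≤2 Dw) (invert (domDeg w) (subst (1 ≤_) (saving-nonD Dw) 1≤))
      where
      invert : ∀ m → 1 ≤ 2 ∸ (3 ∸ m) → 2 ≤ m
      invert 0 ()
      invert 1 ()
      invert (suc (suc m)) _ = s≤s (s≤s z≤n)

    saved-term⁻ : ∀ {v w} → 1 ≤ ⟦ G v w ⟧ * saving w → Adj G v w × 1 ≤ saving w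
    saved-term⁻ {v} {w} 1≤ with G v w
    ... | true = refl , subst (1 ≤_) (+-identityʳ (saving w)) 1≤

    -- Something is saved, so some neighbour has a positive saving. It lies outside `D`, and then a
    -- positive saving means two neighbours in `D`.
    B-neighbour : ∀ {a} → D a ≡ true → ∃ λ b → Adj G a b × label b ≡ B
    B-neighbour {a} Da =
      let (b , 1≤)    = positive-term (λ w → ⟦ G a w ⟧ * saving w) (saved≥1 Da)
          (a~b , 1≤s) = saved-term⁻ 1≤
          Db          = D-nbr Da a~b
      in b , a~b , label-B Db (saving≥1⁻ Db 1≤s)

    -- Two such neighbours would save at least 1 each, against a total of 1.
    B-neighbour-unique : ∀ {a b b′} → D a ≡ true → Adj G a b → domDeg b ≡ 2 →
      Adj G a b′ → domDeg b′ ≡ 2 → b ≡ b′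
    B-neighbour-unique {a} {b} {b′} Da a~b mb a~b′ mb′ = decidable-stable (b ≟ b′) λ b≢b′ →
      1+n≰n (≤-trans (+-mono-≤ (saving≥1 (≤-reflexive (sym mb))) (saving≥1 (≤-reflexive (sym mb′))))
        (≤-trans (2-savings≤saved a~b a~b′ b≢b′) (≤-reflexive (proj₂ (D-tight Da)))))

    -- By tightness `a` is not a leaf, so it has a neighbour besides its B-neighbour. That one is
    -- outside `D` and, by uniqueness, not labelled B.
    C-neighbour : ∀ {a} → D a ≡ true → ∃ λ c → Adj G a c × label c ≡ C
    C-neighbour {a} Da =
      let (b , a~b , lb)     = B-neighbour Da
          mb                 = proj₂ (label-B⁻ lb)
          1≤d                = subst (λ x → ⟦ x ⟧ ≤ deg G a) a~b (1-term≤sum (λ w → ⟦ G a w ⟧) b)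
          (c , c≢b , 1≤)     = other-positive-term (λ w → ⟦ G a w ⟧) b
                                 (subst (λ x → ⟦ x ⟧ < deg G a) (sym a~b) (internal 1≤d (proj₁ (D-tight Da))))
          a~c                = ⟦⟧⁻ 1≤
      in c , a~c , label-C (D-nbr Da a~c) λ mc → c≢b (B-neighbour-unique Da a~c mc a~b mb)
      where
      internal : ∀ {d} → 1 ≤ d → nonLeaf d ≡ 1 → 1 < d
      internal {1} _ ()
      internal {suc (suc d)} _ _ = s≤s (s≤s z≤n)

    D-≢ : ∀ {u v} → D u ≡ true → D v ≡ false → u ≢ v
    D-≢ Du Dv refl = true≢false Du Dv

    label-≢A : ∀ {v} → label v ≢ A → D v ≡ false
    label-≢A {v} ≢A with D-or-not v
    ... | inj₁ Dv = contradiction (label-A Dv) ≢A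
    ... | inj₂ Dv = Dv

    -- A neighbour outside `D` would be a third one beside the two in `D`, contradicting `deg≤2`.
    B-neighbours : ∀ {b v} → label b ≡ B → Adj G b v → D v ≡ true
    B-neighbours {b} {v} lb b~v with D-or-not v
    ... | inj₁ Dv = Dv
    ... | inj₂ Dv =
      let (Db , mb) = label-B⁻ lb
          (u , Du , b~u) = dominated Db
          (u′ , u′≢u , Du′ , b~u′) = second-D-neighbour (≤-reflexive (sym mb)) Du b~u
      in ⊥-elim (no-3-neighbours Db b~v b~u b~u′ (D-≢ Du Dv ∘ sym) (D-≢ Du′ Dv ∘ sym) (u′≢u ∘ sym))

    patterned : Patterned G label
    patterned = record
      { A-A-free = λ la e lv → true≢false (label-A⁻ lv) (D-nbr (label-A⁻ la) e)
      ; A-B = B-neighbour ∘ label-A⁻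
      ; A-B-unique = λ la e lb e′ lb′ →
          B-neighbour-unique (label-A⁻ la) e (proj₂ (label-B⁻ lb)) e′ (proj₂ (label-B⁻ lb′))
      ; A-C = C-neighbour ∘ label-A⁻
      ; B-A = λ lb e → label-A (B-neighbours lb e)
      ; B-second = λ lb e →
          let (a′ , a′≢a , _ , e′) = second-D-neighbour
                (≤-reflexive (sym (proj₂ (label-B⁻ lb)))) (B-neighbours lb e) e
          in a′ , e′ , a′≢a
      ; B-no-third = λ lb → no-3-neighbours (proj₁ (label-B⁻ lb))
      ; C-A = λ lc → let (a , Da , e) = dominated (proj₁ (label-C⁻ lc)) in a , e , label-A Da
      ; C-A-unique = λ {c} {a} {a′} lc e la e′ la′ → decidable-stable (a ≟ a′) λ a≢a′ →
          let (Dc , mc≢2) = label-C⁻ lc in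
          mc≢2 (≤-antisym (domDeg≤2 Dc) (domDeg≥2 (label-A⁻ la) e (label-A⁻ la′) e′ a≢a′))
      ; C-C-unique = λ {c} {x} {y} lc ex lx ey ly → decidable-stable (x ≟ y) λ x≢y →
          let (Dc , _) = label-C⁻ lc
              (u , Du , eu) = dominated Dc
          in no-3-neighbours Dc eu ex ey (D-≢ Du (label-≢A lx)) (D-≢ Du (label-≢A ly)) x≢y
      }

    D-vertex : ∃ λ a → label a ≡ A
    D-vertex with D-or-not r
    ... | inj₁ Dr = r , label-A Dr
    ... | inj₂ Dr = let (a , Da , _) = dominated Dr in a , label-A Da

-- The family 𝒯

InT⇒Built : ∀ {m H S} → InT m H S → Built H
InT⇒Built base          = leaf (leaf (leaf (leaf root 0F) 0F) 0F) 0F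
InT⇒Built (op1 t v _)   = leaf (InT⇒Built t) v
InT⇒Built (op2 t v _ _) = leaf (leaf (leaf (leaf (leaf (InT⇒Built t) v) 0F) 0F) 0F) 0F

-- Only the existence of neighbours is claimed, which the addition of further vertices cannot
-- destroy.
Supports : ∀ {m} → Graph m → Labeling m → Fin m → Status → Set
Supports H S v A = (∃ λ b → Adj H v b × S b ≡ B) × (∃ λ c → Adj H v c × S c ≡ C)
Supports H S v B = ∃₂ λ a a′ → a ≢ a′ × (Adj H v a × S a ≡ A) × (Adj H v a′ × S a′ ≡ A)
Supports H S v C = ∃ λ a → Adj H v a × S a ≡ A

Supported : ∀ {m} → Graph m → Labeling m → Set
Supported H S = ∀ v → Supports H S v (S v)

Supports-addLeaf : ∀ {m} {H : Graph m} {S u s v} x → Supports H S v x →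
  Supports (addLeaf H u) (addLab S s) (suc v) x
Supports-addLeaf A ((b , eb , lb) , (c , ec , lc)) = (suc b , eb , lb) , (suc c , ec , lc)
Supports-addLeaf B (a , a′ , a≢a′ , (e , l) , (e′ , l′)) =
  suc a , suc a′ , a≢a′ ∘ suc-injective , (e , l) , (e′ , l′)
Supports-addLeaf C (a , e , l) = suc a , e , l

InT⇒Supported : ∀ {m H S} → InT m H S → Supported H S
InT⇒Supported base 0F = 1F , refl , refl
InT⇒Supported base 1F = (2F , refl , refl) , (0F , refl , refl)
InT⇒Supported base 2F = 1F , 3F , (λ ()) , (refl , refl) , (refl , refl)
InT⇒Supported base 3F = (2F , refl , refl) , (4F , refl , refl)
InT⇒Supported base 4F = 3F , refl , refl
InT⇒Supported (op1 t v lv) zero = suc v , ⌊≟⌋-refl v , lv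
InT⇒Supported (op1 {S = S} t v lv) (suc i) = Supports-addLeaf (S i) (InT⇒Supported t i)
InT⇒Supported (op2 t v _ _) 0F = 1F , refl , refl
InT⇒Supported (op2 t v _ _) 1F = (2F , refl , refl) , (0F , refl , refl)
InT⇒Supported (op2 t v _ _) 2F = 1F , 3F , (λ ()) , (refl , refl) , (refl , refl)
InT⇒Supported (op2 t v _ _) 3F = (2F , refl , refl) , (4F , refl , refl)
InT⇒Supported (op2 t v _ _) 4F = 3F , refl , refl
InT⇒Supported (op2 {S = S} t v _ _) (suc (suc (suc (suc (suc i))))) =
  lift (lift (lift (lift (lift (InT⇒Supported t i)))))
  where
  lift : ∀ {m} {H : Graph m} {S′ u s j} → Supports H S′ j (S i) →
    Supports (addLeaf H u) (addLab S′ s) (suc j) (S i)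
  lift = Supports-addLeaf (S i)

Supported-A⇒deg≥2 : ∀ {m} {H : Graph m} {S v} → Supported H S → S v ≡ A → 2 ≤ deg H v
Supported-A⇒deg≥2 {H = H} {S} {v} supp lv with S v | supp v
Supported-A⇒deg≥2 {H = H} {S} {v} supp refl | A | (b , eb , lb) , (c , ec , lc) =
  subst₂ (λ x y → ⟦ x ⟧ + ⟦ y ⟧ ≤ deg H v) eb ec (2-terms≤sum (λ w → ⟦ H v w ⟧) b≢c)
  where
  b≢c : b ≢ c
  b≢c refl with trans (sym lb) lc
  ... | ()

isA : Status → Bool
isA A = true
isA B = false
isA C = false

-- Operation 𝒪₁ changes neither side: its leaf is hung on a vertex that is already internal.
-- Operation 𝒪₂ adds two A-vertices and five non-leaves, that is 10 on both sides.
InT-count : ∀ {m H S} → InT m H S → 5 * sum (λ v → ⟦ isA (S v) ⟧) ≡ 2 * (nonLeaves H + 2)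
InT-count base = refl
InT-count (op1 {G = H} t v lv) = trans (InT-count t)
  (cong (λ N → 2 * (N + 2)) (sym (nonLeaves-addLeaf-internal H v (Supported-A⇒deg≥2 (InT⇒Supported t) lv))))
InT-count (op2 {G = H} {S} t v _ d≡1) = begin
  5 * (2 + a)               ≡⟨ *-distribˡ-+ 5 2 a ⟩
  10 + 5 * a                ≡⟨ cong (10 +_) (InT-count t) ⟩
  10 + 2 * (N + 2)          ≡⟨ *-distribˡ-+ 2 5 (N + 2) ⟨
  2 * (5 + (N + 2))         ≡⟨ cong (λ N → 2 * (N + 2)) (nonLeaves-attachP5 H v (trans (sym (count≡sum (H v))) d≡1)) ⟨
  2 * (nonLeaves (attachP5 H v) + 2) ∎
  where
  open ≡-Reasoning
  a = sum (λ v → ⟦ isA (S v) ⟧)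
  N = nonLeaves H

-- From the local structure to membership in 𝒯

module Labelled {n} {G : Graph n} (tree : IsTree G) {S : Labeling n} (pat : Patterned G S) where
  open IsTree tree using (connected)
  open Tree tree
  open Patterned pat

  ≢-label : ∀ {u v x y} → S u ≡ x → S v ≡ y → x ≢ y → u ≢ v
  ≢-label lu lv x≢y refl = x≢y (trans (sym lu) lv)

  Grown : ∀ m → (Fin m → Fin n) → Set
  Grown m f = Σ (Graph m) λ H → Σ (Labeling m) λ S′ →
    InT m H S′ × Embedding H G f × (∀ i → S (f i) ≡ S′ i)

  -- A path labelled C A B A C that starts at `c₁`. It serves both as the initial `P5` and as the
  -- path attached by 𝒪₂.
  record Tail (c₁ : Fin n) (a : Fin n) : Set where
    field
      b a′ c₂ : Fin n
      c₁~a  : Adj G c₁ a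
      a~b   : Adj G a b
      b~a′  : Adj G b a′
      a′~c₂ : Adj G a′ c₂
      la    : S a ≡ A
      lb    : S b ≡ B
      la′   : S a′ ≡ A
      lc₂   : S c₂ ≡ C
      a′≢a  : a′ ≢ a

  tail : ∀ {c a} → Adj G c a → S a ≡ A → Tail c a
  tail c~a la =
    let (b , a~b , lb)      = A-B la
        (a′ , b~a′ , a′≢a)  = B-second lb (Adj-sym a~b)
        la′                 = B-A lb b~a′
        (c₂ , a′~c₂ , lc₂)  = A-C la′
    in record { c₁~a = c~a ; a~b = a~b ; b~a′ = b~a′ ; a′~c₂ = a′~c₂
              ; la = la ; lb = lb ; la′ = la′ ; lc₂ = lc₂ ; a′≢a = a′≢a }

  -- Only `a` has to be known to be fresh. Each later vertex is adjacent to the leaf added just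
  -- before, so by `fresh` it need only differ from that leaf's own neighbour; labels show this for
  -- `b` and `c₂`, and `a′≢a` for `a′`.
  attachTail : ∀ {m} {H : Graph (suc m)} {f : Fin (suc m) → Fin n} {a} → Built H → Embedding H G f →
    S (f zero) ≡ C → Fresh f a → (t : Tail (f zero) a) → let open Tail t in
    Embedding (addLeaf (addLeaf (addLeaf (addLeaf H 0F) 0F) 0F) 0F) G (c₂ ◂ (a′ ◂ (b ◂ (a ◂ f))))
  attachTail {H = H} bH e lc a∉ t = extend (leaf (leaf (leaf bH 0F) 0F) 0F) e₃
      (fresh e₃ a′~c₂ (≢-label lc₂ lb λ ())) a′~c₂
    where
    open Tail t
    e₁ = extend bH e a∉ c₁~a
    e₂ = extend (leaf bH 0F) e₁ (fresh e₁ a~b (≢-label lb lc λ ())) a~b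
    e₃ = extend (leaf (leaf bH 0F) 0F) e₂ (fresh e₂ b~a′ a′≢a) b~a′

  start : ∀ {a} → S a ≡ A → ∃ λ f → Grown 5 f
  start la =
    let (c , a~c , lc) = A-C la
        t = tail (Adj-sym a~c) la
    in _ , P5 , P5lab , base ,
       attachTail root (single c) lc (λ _ → Adj-irrefl (Adj-sym a~c)) t ,
       λ { 0F → Tail.lc₂ t ; 1F → Tail.la′ t ; 2F → Tail.lb t ; 3F → la ; 4F → lc }

  -- By `InT⇒Supported` the copy already contains the neighbours that `Patterned` limits in number:
  -- the B-neighbour of an A-vertex, both neighbours of a B-vertex, the A-neighbour of a C-vertex.
  -- Hence `y` is a C-vertex next to an A-vertex (𝒪₁) or next to a C-vertex (𝒪₂).
  enlarge : ∀ {m f} → Grown m f → ∀ {i y} → Fresh f y → Adj G (f i) y →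
            ∃₂ λ m′ f′ → m ≤ m′ × Grown (suc m′) f′
  enlarge {m} {f} (H , S′ , t , e , l) {i} {y} y∉ x~y with S′ i in li | InT⇒Supported t i
  ... | A | (b , eb , lb) , _ with S y in ly
  ...   | A = contradiction ly (A-A-free (trans (l i) li) x~y)
  ...   | B = contradiction (A-B-unique (trans (l i) li) (trans (induced e i b) eb) (trans (l b) lb) x~y ly) (y∉ b)
  ...   | C = m , y ◂ f , ≤-refl , addLeaf H i , addLab S′ C , op1 t i li , extend (InT⇒Built t) e y∉ x~y ,
              λ { zero → ly ; (suc j) → l j }
  enlarge {m} {f} (H , S′ , t , e , l) {i} {y} y∉ x~y
      | B | p , q , p≢q , (ep , _) , (eq , _) =
    ⊥-elim (B-no-third (trans (l i) li) (trans (induced e i p) ep) (trans (induced e i q) eq) x~y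
      (p≢q ∘ injective e) (y∉ p) (y∉ q))
  enlarge {m} {f} (H , S′ , t , e , l) {i} {y} y∉ x~y
      | C | p , ep , lp with S y in ly
  ... | A = contradiction (C-A-unique lx (trans (induced e i p) ep) (trans (l p) lp) x~y ly) (y∉ p)
    where lx = trans (l i) li
  ... | B = contradiction (trans (sym (trans (l i) li)) (B-A ly (Adj-sym x~y))) λ ()
  ... | C = 4 + m , _ , m≤n+m m 4 , attachP5 H i , attachP5lab S′ , op2 t i li degree≡1 ,
            attachTail (leaf bH i) e₀ ly
              (fresh e₀ (Tail.c₁~a tl) (≢-label (Tail.la tl) lx λ ())) tl ,
            λ { 0F → Tail.lc₂ tl ; 1F → Tail.la′ tl ; 2F → Tail.lb tl ; 3F → Tail.la tl ; 4F → ly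
              ; (suc (suc (suc (suc (suc j))))) → l j }
    where
    lx : S (f i) ≡ C
    lx = trans (l i) li
    bH : Built H
    bH = InT⇒Built t
    e₀ : Embedding (addLeaf H i) G (y ◂ f)
    e₀ = extend bH e y∉ x~y
    tl : Tail y (proj₁ (C-A ly))
    tl = let (_ , y~a , la) = C-A ly in tail y~a la
    -- A neighbour other than `p` within the copy is not labelled A, and a C-vertex has at most one
    -- such neighbour; here that is `y`, which lies outside the copy.
    only-p : ∀ j → H i j ≡ ⌊ j ≟ p ⌋
    only-p j with j ≟ p
    ... | yes refl = ep
    ... | no j≢p with H i j in ej
    ...   | false = refl
    ...   | true  = contradiction
      (C-C-unique lx (trans (induced e i j) ej)
        (λ lj → j≢p (injective e (C-A-unique lx (trans (induced e i j) ej) lj (trans (induced e i p) ep) (trans (l p) lp))))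
        x~y (λ ly′ → contradiction (trans (sym ly) ly′) λ ()))
      (y∉ j)
    degree≡1 : degree H i ≡ 1
    degree≡1 = trans (count≡sum (H i)) (trans (sum-cong-≗ (λ j → cong ⟦_⟧ (only-p j))) (sum-indicator p))

  inFamily : ∀ {a} → S a ≡ A → InFamily G S
  inFamily {a} la
    -- The initial copy of `P5` has `suc 4` vertices, hence the bound `n ≤ 4 + n` for fuel `n`.
    with Growth.grow connected Grown (λ (_ , _ , _ , e , _) → injective e) enlarge n (m≤n+m n 4) (proj₂ (start la))
  ... | m , f , (H , S′ , t , e , l) , onto with surjection⇒permutation (injective e) onto
  ... | π , π≡f with ↔⇒≡ π
  ... | refl = H , S′ , t , π ,
    (λ u v → trans (cong₂ G (π≡f u) (π≡f v)) (induced e u v)) ,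
    (λ u → trans (cong S (π≡f u)) (l u))

-- The A-vertices of a member of 𝒯 as a semitotal dominating set

Supported⇒SemitotalDominating : ∀ {n} {G : Graph n} {S} → Symmetric G → Supported G S →
  IsSemitotalDominating G (isA ∘ S)
Supported⇒SemitotalDominating {G = G} {S} symmetric supp = record { dominating = dom ; semitotal = semi }
  where
  flip : ∀ {u v} → Adj G u v → Adj G v u
  flip {u} {v} e = trans (symmetric v u) e
  dom : ∀ v → isA (S v) ≡ false → ∃ λ u → isA (S u) ≡ true × Adj G u v
  dom v _ with S v | supp v
  dom v () | A | _
  dom v _  | B | a , _ , _ , (e , la) , _ = a , cong isA la , flip e
  dom v _  | C | a , e , la               = a , cong isA la , flip e
  semi : ∀ v → isA (S v) ≡ true → ∃ λ u → isA (S u) ≡ true × u ≢ v × Within2 G u v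
  semi v _ with S v | supp v
  semi v () | B | _
  semi v () | C | _
  -- The B-neighbour `b` of `v` has two distinct A-neighbours. One that differs from `v` is at
  -- distance at most 2 through `b`.
  semi v _  | A | (b , v~b , lb) , _ with S b | supp b
  ... | B | a , a′ , a≢a′ , (b~a , la) , (b~a′ , la′) with a ≟ v
  ...   | yes refl = a′ , cong isA la′ , a≢a′ ∘ sym , inj₂ (b , flip b~a′ , flip v~b)
  ...   | no a≢v   = a , cong isA la , a≢v , inj₂ (b , flip b~a , flip v~b)

InFamily⇒Supported : ∀ {n} {G : Graph n} {S} → InFamily G S → Supported G S
InFamily⇒Supported {G = G} {S} (H , S′ , t , π , iso , lab) v =
  subst (λ v → Supports G S v (S v)) (inverseʳ π)
    (subst (Supports G S _) (sym (lab (π ⟨$⟩ˡ v))) (transport (S′ (π ⟨$⟩ˡ v)) (InT⇒Supported t (π ⟨$⟩ˡ v))))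
  where
  adj : ∀ {i j} → Adj H i j → Adj G (π ⟨$⟩ʳ i) (π ⟨$⟩ʳ j)
  adj e = trans (iso _ _) e
  transport : ∀ {i} x → Supports H S′ i x → Supports G S (π ⟨$⟩ʳ i) x
  transport A ((b , eb , lb) , (c , ec , lc)) =
    (π ⟨$⟩ʳ b , adj eb , trans (lab b) lb) , (π ⟨$⟩ʳ c , adj ec , trans (lab c) lc)
  transport B (a , a′ , a≢a′ , (e , l) , (e′ , l′)) =
    π ⟨$⟩ʳ a , π ⟨$⟩ʳ a′ ,
    (λ πa≡πa′ → a≢a′ (trans (sym (inverseˡ π)) (trans (cong (π ⟨$⟩ˡ_) πa≡πa′) (inverseˡ π)))) ,
    (adj e , trans (lab a) l) , (adj e′ , trans (lab a′) l′)
  transport C (a , e , l) = π ⟨$⟩ʳ a , adj e , trans (lab a) l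

InFamily-count : ∀ {n} {G : Graph n} {S} → InFamily G S → 5 * size (isA ∘ S) ≡ 2 * (nonLeaves G + 2)
InFamily-count {G = G} {S} (H , S′ , t , π , iso , lab) = begin
  5 * size (isA ∘ S)                 ≡⟨ cong (5 *_) (count≡sum (isA ∘ S)) ⟩
  5 * sum (λ v → ⟦ isA (S v) ⟧)      ≡⟨ cong (5 *_) (sum-permute (λ v → ⟦ isA (S v) ⟧) π) ⟩
  5 * sum (λ u → ⟦ isA (S (π ⟨$⟩ʳ u)) ⟧)
                                     ≡⟨ cong (5 *_) (sum-cong-≗ (λ u → cong (⟦_⟧ ∘ isA) (lab u))) ⟩
  5 * sum (λ u → ⟦ isA (S′ u) ⟧)     ≡⟨ InT-count t ⟩
  2 * (nonLeaves H + 2)              ≡⟨ cong (λ N → 2 * (N + 2)) (Iso.sum-deg-iso π iso nonLeaf) ⟨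
  2 * (nonLeaves G + 2)              ∎
  where open ≡-Reasoning

theorem2p5 : (n : ℕ) (T : Graph n) → IsTree T → 2 ≤ n →
    (k : ℕ) → IsGammaT2 T k →
    ((5 * k ≡ 2 * (n ∸ leaves T + 2)) ⇔ Σ (Labeling n) λ S → InFamily T S)
theorem2p5 (suc n) T tree _ k γ = mk⇔ to from
  where
  open IsGammaT2 γ
  D : VSet (suc n)
  D = proj₁ attained
  std : IsSemitotalDominating T D
  std = proj₁ (proj₂ attained)
  open Discharging tree std
  k≡ : k ≡ sum (λ v → ⟦ D v ⟧)
  k≡ = trans (sym (proj₂ (proj₂ attained))) (count≡sum D)
  bound≡ : 2 * (suc n ∸ leaves T + 2) ≡ 2 * (nonLeaves T + 2)
  bound≡ = cong (λ N → 2 * (N + 2)) (nonLeaves-leaves T)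

  to : 5 * k ≡ 2 * (suc n ∸ leaves T + 2) → Σ (Labeling (suc n)) λ S → InFamily T S
  to 5k≡ = label , Labelled.inFamily tree patterned (proj₂ D-vertex)
    where open Tight zero (trans (cong (5 *_) (sym k≡)) (trans 5k≡ bound≡))

  from : (Σ (Labeling (suc n)) λ S → InFamily T S) → 5 * k ≡ 2 * (suc n ∸ leaves T + 2)
  -- The A-vertices compete with the minimum and give `upper`; discharging on the minimum set `D`
  -- gives `lower`.
  from (S , fam) = trans (≤-antisym upper lower) (sym bound≡)
    where
    upper : 5 * k ≤ 2 * (nonLeaves T + 2)
    upper = ≤-trans
      (*-monoʳ-≤ 5 (minimal (isA ∘ S)
        (Supported⇒SemitotalDominating (IsTree.symmetric tree) (InFamily⇒Supported fam))))
      (≤-reflexive (InFamily-count {G = T} {S} fam))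
    lower : 2 * (nonLeaves T + 2) ≤ 5 * k
    lower = ≤-trans (lower-bound zero) (≤-reflexive (cong (5 *_) (sym k≡)))
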